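{- Every matching covered graph $G$ has $\Theta$ as a conformal minor or has $K_4$ as a conformal minor (or both).
   Context: Graphs are loopless; multiple (parallel) edges are allowed. A graph is matchable if it has a perfect matching. A connected graph, of order two or more, is matching covered if each edge lies in some perfect matching. $\Theta$ is the graph with two vertices joined by three edges. A subgraph $H$ of a graph $G$ is conformal if the graph $G-V(H)$ is matchable (the empty graph is regarded as matchable). To bi-subdivide an edge means to subdivide it by inserting an even number of subdivision vertices; a graph $H$ is a bi-subdivision of a graph $J$ if $H$ may be obtained from $J$ by bi-subdividing each edge in some subset of $E(J)$. A matching covered graph $J$ is a conformal minor of a matching covered graph $G$ if $G$ has a conformal subgraph that is a bi-subdivision of $J$.
   Formalization: The graph G is additionally assumed to be neither K_2 nor an even cycle (including two parallel edges); these are matching covered but have maximum degree at most two, so they have neither Θ nor K_4 as a conformal minor. -}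

module Defs where

open import Data.Bool using (Bool; T; not; _∧_)
open import Data.Bool.Properties using (T-∧)
open import Data.Fin using (Fin; zero; suc; toℕ; fromℕ; inject₁; _<_)
open import Data.Fin.Properties using (toℕ-inject₁; <⇒≢)
open import Data.Fin.Relation.Unary.Top using (View; view; ‵fromℕ; ‵inject₁)
open import Data.Nat using (ℕ; zero; suc; _+_; _*_; _≤_)
open import Data.Nat.Properties using (1+n≢n)
open import Data.Product using (Σ; ∃; ∃₂; ∃!; _×_; _,_; proj₁; proj₂)
open import Data.Sum using (_⊎_; inj₁; inj₂)
open import Data.Sum.Properties using (inj₁-injective)
open import Function using (_∘_)
open import Function.Bundles using (_↔_; Inverse; Equivalence)
open import Relation.Binary.Construct.Closure.ReflexiveTransitive using (Star)
open import Relation.Binary.PropositionalEquality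
  using (_≡_; _≢_; refl; sym; trans; cong)

-- Undirected multigraphs without loops.  Each edge stores its two ends in an
-- arbitrary order; every notion below is insensitive to that order.
-- Finiteness is part of `MatchingCovered`, so that vertex-deleted subgraphs
-- need not be renumbered.
record Graph : Set₁ where
  field
    V E      : Set
    src tgt  : E → V
    loopless : ∀ e → src e ≢ tgt e

open Graph public

record Finite (G : Graph) : Set where
  field
    order size : ℕ
    vertices   : V G ↔ Fin order
    edges      : E G ↔ Fin size

open Finite public

Incident : (G : Graph) → E G → V G → Set
Incident G e v = src G e ≡ v ⊎ tgt G e ≡ v

Joins : (G : Graph) → E G → V G → V G → Set
Joins G e u v = (src G e ≡ u × tgt G e ≡ v) ⊎ (src G e ≡ v × tgt G e ≡ u)

Adjacent : (G : Graph) → V G → V G → Set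
Adjacent G u v = ∃ λ e → Joins G e u v

Connected : Graph → Set
Connected G = ∀ u v → Star (Adjacent G) u v

record _≅_ (G H : Graph) : Set where
  field
    onV   : V G ↔ V H
    onE   : E G ↔ E H
    joins : ∀ e → Joins H (Inverse.to onE e)
                          (Inverse.to onV (src G e)) (Inverse.to onV (tgt G e))

infix 4 _≅_

IsPerfectMatching : (G : Graph) → (E G → Bool) → Set
IsPerfectMatching G M = ∀ v → ∃! _≡_ λ e → T (M e) × Incident G e v

Matchable : Graph → Set
Matchable G = ∃ λ M → IsPerfectMatching G M

record MatchingCovered (G : Graph) : Set where
  field
    finite    : Finite G
    order≥2   : 2 ≤ order finite
    connected : Connected G
    covered   : ∀ e → ∃ λ M → IsPerfectMatching G M × T (M e)

record Subgraph (G : Graph) : Set where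
  field
    inV   : V G → Bool
    inE   : E G → Bool
    src-∈ : ∀ e → T (inE e) → T (inV (src G e))
    tgt-∈ : ∀ e → T (inE e) → T (inV (tgt G e))

open Subgraph public

asGraph : {G : Graph} → Subgraph G → Graph
asGraph {G} H = record
  { V        = ∃ λ v → T (inV H v)
  ; E        = ∃ λ e → T (inE H e)
  ; src      = λ (e , p) → src G e , src-∈ H e p
  ; tgt      = λ (e , p) → tgt G e , tgt-∈ H e p
  ; loopless = λ (e , _) eq → loopless G e (cong proj₁ eq)
  }

delete : (G : Graph) → (V G → Bool) → Subgraph G
delete G X = record
  { inV   = not ∘ X
  ; inE   = λ e → not (X (src G e)) ∧ not (X (tgt G e))
  ; src-∈ = λ e p → proj₁ (Equivalence.to T-∧ p)
  ; tgt-∈ = λ e p → proj₂ (Equivalence.to (T-∧ {not (X (src G e))}) p)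
  }

Conformal : {G : Graph} → Subgraph G → Set
Conformal {G} H = Matchable (asGraph (delete G (inV H)))

-- Edge e of J becomes a path with k e internal vertices (e , 0), (e , 1), …
-- from src e to tgt e.  Its i-th edge runs from `before i` to `after i`.
module _ (J : Graph) (k : E J → ℕ) where

  SubdividedV : Set
  SubdividedV = V J ⊎ Σ (E J) (λ e → Fin (k e))

  before : ∀ e → Fin (suc (k e)) → SubdividedV
  before e zero    = inj₁ (src J e)
  before e (suc i) = inj₂ (e , i)

  afterView : ∀ e {i : Fin (suc (k e))} → View i → SubdividedV
  afterView e ‵fromℕ       = inj₁ (tgt J e)
  afterView e (‵inject₁ i) = inj₂ (e , i)

  after : ∀ e → Fin (suc (k e)) → SubdividedV
  after e i = afterView e (view i)

  private
    index : SubdividedV → ℕ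
    index (inj₁ _)       = 0
    index (inj₂ (_ , i)) = suc (toℕ i)

    index-before : ∀ e i → index (before e i) ≡ toℕ i
    index-before e zero    = refl
    index-before e (suc i) = refl

    before-inj₁ : ∀ e i {v} → before e i ≡ inj₁ v → src J e ≡ v
    before-inj₁ e zero eq = inj₁-injective eq

    before≢after : ∀ e {i} (w : View i) → before e i ≢ afterView e w
    before≢after e ‵fromℕ       eq = loopless J e (before-inj₁ e (fromℕ (k e)) eq)
    before≢after e (‵inject₁ j) eq =
      1+n≢n (trans (sym (cong index eq))
                   (trans (index-before e (inject₁ j)) (toℕ-inject₁ j)))

  subdivide : Graph
  subdivide = record
    { V        = SubdividedV
    ; E        = Σ (E J) (λ e → Fin (suc (k e)))
    ; src      = λ (e , i) → before e i
    ; tgt      = λ (e , i) → after e i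
    ; loopless = λ (e , i) → before≢after e (view i)
    }

_IsBiSubdivisionOf_ : Graph → Graph → Set
H IsBiSubdivisionOf J = ∃ λ (h : E J → ℕ) → H ≅ subdivide J (λ e → 2 * h e)

_IsConformalMinorOf_ : Graph → Graph → Set
J IsConformalMinorOf G =
  ∃ λ (H : Subgraph G) → Conformal H × asGraph H IsBiSubdivisionOf J

Θ : Graph
Θ = record
  { V        = Fin 2
  ; E        = Fin 3
  ; src      = λ _ → zero
  ; tgt      = λ _ → suc zero
  ; loopless = λ _ ()
  }

complete : ℕ → Graph
complete n = record
  { V        = Fin n
  ; E        = ∃₂ λ (i j : Fin n) → i < j
  ; src      = λ (i , _ , _) → i
  ; tgt      = λ (_ , j , _) → j
  ; loopless = λ (_ , _ , i<j) → <⇒≢ i<j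
  }

K₂ K₄ : Graph
K₂ = complete 2
K₄ = complete 4

-- The cycle on n + 2 vertices; for n = 0 it consists of two parallel edges.
cycle : ℕ → Graph
cycle n = record
  { V        = Fin (2 + n)
  ; E        = Fin (2 + n)
  ; src      = λ { zero → fromℕ (1 + n) ; (suc i) → inject₁ i }
  ; tgt      = λ i → i
  ; loopless = λ { zero () ; (suc i) eq → 1+n≢n (trans (sym (cong toℕ eq)) (toℕ-inject₁ i)) }
  }

-- K₂ and the even cycles are matching covered, but have neither Θ nor K₄ as a
-- conformal minor: their vertices have degree at most two.
IsEvenCycle : Graph → Set
IsEvenCycle G = ∃ λ m → G ≅ cycle (2 * m)

{-# OPTIONS --safe #-}

-- Let M be a perfect matching.  Unless G is K₂, some edge avoids M, and M with
-- a perfect matching through that edge yields an M-alternating cycle C.  Unless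
-- G is an even cycle, some edge g leaves C; let L be a perfect matching
-- through g.  Following L and M alternately from a vertex of C whose L-edge is
-- not on C, one traces an ear of odd length until C is met again.  An ear
-- whose ends have different parity on C forms a Θ together with C.  If the
-- ends i < j have equal parity, an odd number of vertices of C lies strictly
-- between them, so that an ear starts from some k of the other parity.  The ear
-- from k forms a Θ with C, crosses the ear from i to j, giving a K₄, or spans
-- a shorter part of C, and one concludes by descent.  All these subgraphs are
-- conformal since they are closed under M.
module Submission where

open import Defs
open import Data.Bool as Bool using (Bool; true; false; not; T; T?; if_then_else_)
open import Data.Bool.Properties using (T-∧; T-irrelevant; not-involutive; not-¬; ¬-not; not-injective)
open import Data.Empty using (⊥-elim)
open import Data.Fin using (Fin; zero; suc; toℕ; fromℕ<)
open import Data.Fin.Properties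
  using (any?; inj⇒≟; pigeonhole; toℕ<n; toℕ-fromℕ; toℕ-fromℕ<; toℕ-inject₁; toℕ-injective)
open import Data.Fin.Relation.Unary.Top using (view; ‵fromℕ; ‵inject₁)
open import Data.Nat using (ℕ; zero; suc; _+_; _*_; _∸_; _≤_; _<_; z≤n; s≤s; s≤s⁻¹; z<s; _/_; _%_)
open import Data.Nat.DivMod using (m≡m%n+[m/n]*n; m%n<n)
open import Data.Nat.Properties
open import Data.Product using (Σ; ∃; _×_; _,_; proj₁; proj₂)
open import Data.Sum using (_⊎_; inj₁; inj₂; [_,_]′)
open import Function using (_∘_)
open import Function.Bundles using (_↔_; Inverse; Injection; Equivalence; mk↔ₛ′)
open import Function.Construct.Identity using (↔-id)
open import Function.Properties.Inverse using (↔⇒↣; ↔-sym)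
open import Relation.Binary.Construct.Closure.ReflexiveTransitive using (Star; ε; _◅_)
open import Relation.Binary.Definitions using (DecidableEquality; tri<; tri≈; tri>)
open import Relation.Binary.PropositionalEquality
  using (_≡_; _≢_; refl; sym; trans; cong; cong₂; subst)
open import Relation.Nullary using (¬_; Dec; yes; no; contradiction)
open import Relation.Nullary.Decidable
  using (map′; ⌊_⌋; toWitness; fromWitness; fromWitnessFalse; toWitnessFalse; _×-dec_; _⊎-dec_; ¬?)

-- Finite types

-- Stands in for finiteness where only exhaustive search matters; it passes to sums and Σ-types
-- without any counting.
Searchable : Set → Set₁
Searchable A = ∀ {P : A → Set} → (∀ a → Dec (P a)) → Dec (∃ P)

↔Fin⇒≟ : ∀ {A : Set} {n} → A ↔ Fin n → DecidableEquality A
↔Fin⇒≟ A↔Fin = inj⇒≟ (↔⇒↣ A↔Fin)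

search-↔ : ∀ {A B : Set} → B ↔ A → Searchable A → Searchable B
search-↔ B↔A search {P} P? =
  map′ (λ (a , p) → from a , p)
       (λ (b , p) → to b , subst P (sym (strictlyInverseʳ b)) p)
       (search (λ a → P? (from a)))
  where open Inverse B↔A

search-⊎ : ∀ {A B : Set} → Searchable A → Searchable B → Searchable (A ⊎ B)
search-⊎ searchA searchB P? =
  map′ [ (λ (a , p) → inj₁ a , p) , (λ (b , p) → inj₂ b , p) ]′
       (λ { (inj₁ a , p) → inj₁ (a , p) ; (inj₂ b , p) → inj₂ (b , p) })
       (searchA (λ a → P? (inj₁ a)) ⊎-dec searchB (λ b → P? (inj₂ b)))

search-Σ : ∀ {A : Set} {B : A → Set} → Searchable A → (∀ a → Searchable (B a)) → Searchable (Σ A B)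
search-Σ searchA searchB P? =
  map′ (λ (a , b , p) → (a , b) , p) (λ ((a , b) , p) → a , b , p)
       (searchA (λ a → searchB a (λ b → P? (a , b))))

bijection : ∀ {A B : Set} (f : A → B) → (∀ {a a′} → f a ≡ f a′ → a ≡ a′) →
            (∀ b → ∃ λ a → f a ≡ b) → B ↔ A
bijection f f-injective f-surjective =
  mk↔ₛ′ (proj₁ ∘ f-surjective) f
        (λ a → f-injective (proj₂ (f-surjective (f a))))
        (proj₂ ∘ f-surjective)

least : {P : ℕ → Set} → (∀ i → Dec (P i)) → ∀ n → P n →
        ∃ λ k → P k × (∀ {i} → i < k → ¬ P i)
least {P} P? n p = go n zero (λ ()) (subst P (sym (+-identityʳ n)) p)
  where
  -- `fuel + k` stays equal to `n`, where `P` is known to hold, so the upward search stops there at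
  -- the latest.
  go : ∀ fuel k → (∀ {i} → i < k → ¬ P i) → P (fuel + k) →
       ∃ λ k → P k × (∀ {i} → i < k → ¬ P i)
  go fuel k below p with P? k
  ... | yes pk = k , pk , below
  go zero k below p | no ¬pk = contradiction p ¬pk
  go (suc fuel) k below p | no ¬pk =
    go fuel (suc k) below′ (subst P (sym (+-suc fuel k)) p)
    where
    below′ : ∀ {i} → i < suc k → ¬ P i
    below′ i<1+k pi with m≤n⇒m<n∨m≡n (s≤s⁻¹ i<1+k)
    ... | inj₁ i<k  = below i<k pi
    ... | inj₂ refl = ¬pk pi

-- Parity

odd? : ℕ → Bool
odd? zero    = false
odd? (suc n) = not (odd? n)

odd?-+2* : ∀ i k → odd? (i + 2 * k) ≡ odd? i
odd?-+2* i zero    = cong odd? (+-identityʳ i)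
odd?-+2* i (suc k)
  rewrite *-suc 2 k | +-suc i (suc (2 * k)) | +-suc i (2 * k) =
  trans (not-involutive _) (odd?-+2* i k)

odd?-+[2+2*] : ∀ i k → odd? (i + (2 + 2 * k)) ≡ odd? i
odd?-+[2+2*] i k = trans (cong (λ n → odd? (i + n)) (sym (*-suc 2 k))) (odd?-+2* i (suc k))

even-or-odd : ∀ n → (∃ λ k → n ≡ 2 * k) ⊎ (∃ λ k → n ≡ suc (2 * k))
even-or-odd zero = inj₁ (zero , refl)
even-or-odd (suc n) with even-or-odd n
... | inj₁ (k , refl) = inj₂ (k , refl)
... | inj₂ (k , refl) = inj₁ (suc k , sym (*-suc 2 k))

-- The summands stand in the order in which `position` adds up arcs, so that corners obtained from
-- here agree with their positions definitionally.
odd-difference : ∀ {i j} → i < j → odd? i ≢ odd? j → ∃ λ k → j ≡ suc (2 * k) + i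
odd-difference {i} i<j p≢q with m≤n⇒∃[o]m+o≡n (<⇒≤ i<j)
... | o , refl with even-or-odd o
... | inj₁ (k , refl) = contradiction (sym (odd?-+2* i k)) p≢q
... | inj₂ (k , refl) = k , +-comm i (suc (2 * k))

even-difference : ∀ {i j} → i < j → odd? i ≡ odd? j → ∃ λ k → j ≡ i + 2 * suc k
even-difference {i} i<j p≡q with m≤n⇒∃[o]m+o≡n (<⇒≤ i<j)
... | o , refl with even-or-odd o
... | inj₁ (zero , refl)  = contradiction (sym (+-identityʳ i)) (<⇒≢ i<j)
... | inj₁ (suc k , refl) = k , refl
... | inj₂ (k , refl) rewrite +-suc i (2 * k) =
  contradiction (trans p≡q (cong not (odd?-+2* i k))) (not-¬ refl)

-- Joins and incidence

module _ {G : Graph} where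

  joins-sym : ∀ {e u v} → Joins G e u v → Joins G e v u
  joins-sym (inj₁ p) = inj₂ p
  joins-sym (inj₂ p) = inj₁ p

  joins⇒incident : ∀ {e u v} → Joins G e u v → Incident G e u
  joins⇒incident (inj₁ (p , _)) = inj₁ p
  joins⇒incident (inj₂ (_ , p)) = inj₂ p

  incident⇒joins : ∀ {e v} → Incident G e v → ∃ λ u → Joins G e v u
  incident⇒joins {e} (inj₁ p) = tgt G e , inj₁ (p , refl)
  incident⇒joins {e} (inj₂ p) = src G e , inj₂ (refl , p)

  incident-joins : ∀ {e u v x} → Joins G e u v → Incident G e x → x ≡ u ⊎ x ≡ v
  incident-joins (inj₁ (refl , refl)) (inj₁ refl) = inj₁ refl
  incident-joins (inj₁ (refl , refl)) (inj₂ refl) = inj₂ refl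
  incident-joins (inj₂ (refl , refl)) (inj₁ refl) = inj₂ refl
  incident-joins (inj₂ (refl , refl)) (inj₂ refl) = inj₁ refl

  joins⇒≢ : ∀ {e u v} → Joins G e u v → u ≢ v
  joins⇒≢ {e} (inj₁ (refl , refl)) u≡v = loopless G e u≡v
  joins⇒≢ {e} (inj₂ (refl , refl)) u≡v = loopless G e (sym u≡v)

  joins-functional : ∀ {e u v v′} → Joins G e u v → Joins G e u v′ → v ≡ v′
  joins-functional j j′ with incident-joins j (joins⇒incident (joins-sym j′))
  ... | inj₂ v′≡v = sym v′≡v
  ... | inj₁ v′≡u = contradiction (sym v′≡u) (joins⇒≢ j′)

-- The maps run from `H` to `G`, the direction in which a subdivision is embedded; the isomorphism
-- then takes preimages.
≅-intro : {G H : Graph} (φ : V H → V G) (ψ : E H → E G) →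
          (∀ {u v} → φ u ≡ φ v → u ≡ v) → (∀ v → ∃ λ u → φ u ≡ v) →
          (∀ {e e′} → ψ e ≡ ψ e′ → e ≡ e′) → (∀ e → ∃ λ e′ → ψ e′ ≡ e) →
          (∀ e → Joins G (ψ e) (φ (src H e)) (φ (tgt H e))) → G ≅ H
≅-intro {G} {H} φ ψ φ-injective φ-surjective ψ-injective ψ-surjective ψ-joins = record
  { onV   = bijection φ φ-injective φ-surjective
  ; onE   = bijection ψ ψ-injective ψ-surjective
  ; joins = joins
  }
  where
  pull : ∀ {v u} → v ≡ φ u → u ≡ proj₁ (φ-surjective v)
  pull {v} v≡φu = φ-injective (trans (sym v≡φu) (sym (proj₂ (φ-surjective v))))

  joins : ∀ e → Joins H (proj₁ (ψ-surjective e)) (proj₁ (φ-surjective (src G e))) (proj₁ (φ-surjective (tgt G e)))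
  joins e with ψ-surjective e
  ... | e′ , refl with ψ-joins e′
  ... | inj₁ (a , b) = inj₁ (pull a , pull b)
  ... | inj₂ (a , b) = inj₂ (pull b , pull a)

-- Perfect matchings as fixed-point-free involutions

record Matching (G : Graph) : Set where
  field
    member  : E G → Bool
    perfect : IsPerfectMatching G member

  edge : V G → E G
  edge v = proj₁ (perfect v)

  edge-incident : ∀ v → Incident G (edge v) v
  edge-incident v = proj₂ (proj₁ (proj₂ (perfect v)))

  edge-member : ∀ v → T (member (edge v))
  edge-member v = proj₁ (proj₁ (proj₂ (perfect v)))

  edge-unique : ∀ {e v} → T (member e) → Incident G e v → edge v ≡ e
  edge-unique {e} {v} e∈M e∼v = proj₂ (proj₂ (perfect v)) (e∈M , e∼v)

  mate : V G → V G
  mate v = proj₁ (incident⇒joins {G} (edge-incident v))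

  edge-joins : ∀ v → Joins G (edge v) v (mate v)
  edge-joins v = proj₂ (incident⇒joins {G} (edge-incident v))

  mate≢ : ∀ v → v ≢ mate v
  mate≢ v = joins⇒≢ {G} (edge-joins v)

  edge-shared : ∀ {u v} → Incident G (edge v) u → edge u ≡ edge v
  edge-shared {v = v} = edge-unique (edge-member v)

  edge-mate : ∀ v → edge (mate v) ≡ edge v
  edge-mate v = edge-shared (joins⇒incident {G} (joins-sym {G} (edge-joins v)))

  mate-mate : ∀ v → mate (mate v) ≡ v
  mate-mate v = joins-functional {G} (edge-joins (mate v))
    (subst (λ e → Joins G e (mate v) v) (sym (edge-mate v)) (joins-sym {G} (edge-joins v)))

open Matching

-- Recognising a bi-subdivision inside a graph

module _ {J : Graph} {k : E J → ℕ} where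

  private S = subdivide J k

  before-inj₁ : ∀ e i {v} → before J k e i ≡ inj₁ v → src J e ≡ v
  before-inj₁ e zero refl = refl

  before-inj₂ : ∀ e i {e′ j} → before J k e i ≡ inj₂ (e′ , j) → e ≡ e′ × toℕ i ≡ suc (toℕ j)
  before-inj₂ e (suc i) refl = refl , refl

  after-inj₁ : ∀ e i {v} → after J k e i ≡ inj₁ v → tgt J e ≡ v
  after-inj₁ e i eq with view i
  after-inj₁ e _ refl | ‵fromℕ = refl

  after-inj₂ : ∀ e i {e′ j} → after J k e i ≡ inj₂ (e′ , j) → e ≡ e′ × toℕ i ≡ toℕ j
  after-inj₂ e i eq with view i
  after-inj₂ e _ refl | ‵inject₁ j = refl , toℕ-inject₁ j

  after-cases : ∀ e i → after J k e i ≡ inj₁ (tgt J e) ⊎ ∃ λ j → after J k e i ≡ inj₂ (e , j)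
  after-cases e i with view i
  ... | ‵fromℕ     = inj₁ refl
  ... | ‵inject₁ j = inj₂ (j , refl)

  -- An internal vertex determines the edge of `J` that it subdivides and its place there. Hence
  -- distinct edges of the subdivision can share both ends only if these are vertices of `J`, that
  -- is, if they come from undivided parallel edges.
  subdivide-simple : ∀ e i e′ i′ → Joins S (e , i) (before J k e′ i′) (after J k e′ i′) →
    (e , i) ≡ (e′ , i′) ⊎ (toℕ i ≡ 0 × toℕ i′ ≡ 0 × Joins J e (src J e′) (tgt J e′))
  subdivide-simple e (suc i) e′ (suc i′) (inj₁ (refl , _)) = inj₁ refl
  subdivide-simple e zero e′ zero (inj₁ (b , a)) with after-cases e zero
  ... | inj₁ a₁ = inj₂ (refl , refl , inj₁ (before-inj₁ e zero b , sym (after-inj₁ e′ zero (trans (sym a) a₁))))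
  ... | inj₂ (_ , a₂) with refl , _ ← after-inj₂ e′ zero (trans (sym a) a₂) = inj₁ refl
  subdivide-simple e (suc i) e′ i′ (inj₂ (b , a)) with after-inj₂ e′ i′ (sym b) | after-cases e (suc i)
  ... | refl , _ | inj₁ a₁ = ⊥-elim (loopless J e (before-inj₁ e i′ (trans (sym a) a₁)))
  -- Two segments of one path running against each other: the index `i` would be two more than
  -- itself.
  ... | refl , i′≡i | inj₂ (j , a₂)
    with _ , 1+i≡j ← after-inj₂ e (suc i) a₂ | _ , i′≡1+j ← before-inj₂ e i′ (trans (sym a) a₂) =
    contradiction (trans (sym i′≡i) (trans i′≡1+j (cong suc (sym 1+i≡j)))) (m≢1+n+m (toℕ i) {1})
  subdivide-simple e zero e′ zero (inj₂ (b , a)) =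
    inj₂ (refl , refl , inj₂ (sym (after-inj₁ e′ zero (sym b)) , after-inj₁ e zero a))
  subdivide-simple e zero e′ (suc i′) (inj₂ (b , a)) with refl , _ ← after-inj₂ e zero a =
    ⊥-elim (loopless J e (sym (after-inj₁ e (suc i′) (sym b))))

module _ {G J : Graph} (_≟V_ : DecidableEquality (V G)) (_≟E_ : DecidableEquality (E G))
         (searchV : Searchable (V J)) (searchE : Searchable (E J))
         (M : Matching G) (h : E J → ℕ) where

  private
    S : Graph
    S = subdivide J (λ e → 2 * h e)

  module Embedding
    (f : V S → V G) (f-injective : ∀ {s s′} → f s ≡ f s′ → s ≡ s′)
    (g : E S → E G) (g-joins : ∀ s → Joins G (g s) (f (src S s)) (f (tgt S s)))
    (g-parallel : ∀ e e′ → g (e , zero) ≡ g (e′ , zero) → Joins J e (src J e′) (tgt J e′) → e ≡ e′)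
    (f-closed : ∀ s → ∃ λ s′ → f s′ ≡ mate M (f s))
    where

    -- Edges with a common image have the same ends, since `f` is injective. By `subdivide-simple`
    -- only parallel edges of `J` remain, and these are the business of `g-parallel`.
    g-injective : ∀ {s s′} → g s ≡ g s′ → s ≡ s′
    g-injective {e , i} {e′ , i′} eq with subdivide-simple e i e′ i′ ends
      where
      ends : Joins S (e , i) (src S (e′ , i′)) (tgt S (e′ , i′))
      ends with incident-joins {G} (g-joins (e , i)) (subst (λ x → Incident G x _) (sym eq) (joins⇒incident {G} (g-joins (e′ , i′))))
              | incident-joins {G} (g-joins (e , i)) (subst (λ x → Incident G x _) (sym eq) (joins⇒incident {G} (joins-sym {G} (g-joins (e′ , i′)))))
      ... | inj₁ p | inj₂ q = inj₁ (sym (f-injective p) , sym (f-injective q))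
      ... | inj₂ p | inj₁ q = inj₂ (sym (f-injective q) , sym (f-injective p))
      ... | inj₁ p | inj₁ q = ⊥-elim (loopless S (e′ , i′) (trans (f-injective p) (sym (f-injective q))))
      ... | inj₂ p | inj₂ q = ⊥-elim (loopless S (e′ , i′) (trans (f-injective p) (sym (f-injective q))))
    ... | inj₁ s≡s′ = s≡s′
    g-injective {e , zero} {e′ , zero} eq | inj₂ (_ , _ , j) with refl ← g-parallel e e′ eq j = refl

    f-image? : ∀ v → Dec (∃ λ s → f s ≡ v)
    f-image? v = search-⊎ searchV (search-Σ searchE (λ _ → any?)) (λ s → f s ≟V v)

    g-image? : ∀ e → Dec (∃ λ s → g s ≡ e)
    g-image? e = search-Σ searchE (λ _ → any?) (λ s → g s ≟E e)

    inImage : V G → Bool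
    inImage v = ⌊ f-image? v ⌋

    ends-inImage : ∀ e → T ⌊ g-image? e ⌋ → T (inImage (src G e)) × T (inImage (tgt G e))
    ends-inImage e p with toWitness {a? = g-image? e} p
    ... | s , refl with g-joins s
    ... | inj₁ (a , b) = fromWitness (_ , sym a) , fromWitness (_ , sym b)
    ... | inj₂ (a , b) = fromWitness (_ , sym a) , fromWitness (_ , sym b)

    image : Subgraph G
    image = record
      { inV   = inImage
      ; inE   = λ e → ⌊ g-image? e ⌋
      ; src-∈ = λ e p → proj₁ (ends-inImage e p)
      ; tgt-∈ = λ e p → proj₂ (ends-inImage e p)
      }

    image≅subdivide : asGraph image ≅ S
    image≅subdivide = ≅-intro
      (λ s → f s , fromWitness (s , refl)) (λ s → g s , fromWitness (s , refl))
      (f-injective ∘ cong proj₁) vertex-preimage (g-injective ∘ cong proj₁) edge-preimage joins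
      where
      vertex-≡ : {u v : V (asGraph image)} → proj₁ u ≡ proj₁ v → u ≡ v
      vertex-≡ refl = cong (_ ,_) (T-irrelevant _ _)

      vertex-preimage : ∀ v → ∃ λ s → (f s , fromWitness (s , refl)) ≡ v
      vertex-preimage (v , p) with toWitness {a? = f-image? v} p
      ... | s , eq = s , vertex-≡ eq

      edge-preimage : ∀ e → ∃ λ s → (g s , fromWitness (s , refl)) ≡ e
      edge-preimage (e , p) with toWitness {a? = g-image? e} p
      ... | s , refl = s , cong (g s ,_) (T-irrelevant _ _)

      joins : ∀ s → Joins (asGraph image) (g s , fromWitness (s , refl))
                (f (src S s) , fromWitness (src S s , refl)) (f (tgt S s) , fromWitness (tgt S s , refl))
      joins s with g-joins s
      ... | inj₁ (a , b) = inj₁ (vertex-≡ a , vertex-≡ b)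
      ... | inj₂ (a , b) = inj₂ (vertex-≡ a , vertex-≡ b)

    -- The image is closed under the involution `mate M`, hence so is its complement, and `M`
    -- restricts to a perfect matching there.
    image-conformal : Conformal image
    image-conformal = (λ (e , _) → member M e) , matched
      where
      outside : ∀ {v} → T (not (inImage v)) → ¬ (∃ λ s → f s ≡ v)
      outside {v} = toWitnessFalse {a? = f-image? v}

      mate-outside : ∀ {v} → T (not (inImage v)) → T (not (inImage (mate M v)))
      mate-outside {v} v∉ = fromWitnessFalse λ (s , fs≡v′) →
        let s′ , fs′≡ = f-closed s in
        outside v∉ (s′ , trans fs′≡ (trans (cong (mate M) fs≡v′) (mate-mate M v)))

      edge-outside : ∀ {v} → T (not (inImage v)) → T (inE (delete G inImage) (edge M v))
      edge-outside {v} v∉ with edge-joins M v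
      ... | inj₁ (p , q) = Equivalence.from T-∧
        (subst (λ x → T (not (inImage x))) (sym p) v∉ , subst (λ x → T (not (inImage x))) (sym q) (mate-outside v∉))
      ... | inj₂ (p , q) = Equivalence.from T-∧
        (subst (λ x → T (not (inImage x))) (sym p) (mate-outside v∉) , subst (λ x → T (not (inImage x))) (sym q) v∉)

      lift : ∀ {e : E G} {v : V G} {p q} → Incident G e v → Incident (asGraph (delete G inImage)) (e , p) (v , q)
      lift (inj₁ refl) = inj₁ (cong (_ ,_) (T-irrelevant _ _))
      lift (inj₂ refl) = inj₂ (cong (_ ,_) (T-irrelevant _ _))

      lower : ∀ {e v} → Incident (asGraph (delete G inImage)) e v → Incident G (proj₁ e) (proj₁ v)
      lower (inj₁ refl) = inj₁ refl
      lower (inj₂ refl) = inj₂ refl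

      unique : ∀ {e e′ : E (asGraph (delete G inImage))} → proj₁ e ≡ proj₁ e′ → e ≡ e′
      unique refl = cong (_ ,_) (T-irrelevant _ _)

      matched : IsPerfectMatching (asGraph (delete G inImage)) (λ (e , _) → member M e)
      matched (v , v∉) = (edge M v , edge-outside v∉) , (edge-member M v , lift (edge-incident M v)) ,
        λ (e∈M , e∼v) → unique (edge-unique M e∈M (lower e∼v))

    conformalMinor : J IsConformalMinorOf G
    conformalMinor = image , image-conformal , h , image≅subdivide

-- Alternating walks

module Walk {G : Graph} (μ : Bool → Matching G) where

  walk : V G → ℕ → V G
  walk v zero    = v
  walk v (suc i) = mate (μ (odd? i)) (walk v i)

  walk-edge : V G → ℕ → E G
  walk-edge v i = edge (μ (odd? i)) (walk v i)

  walk-joins : ∀ v i → Joins G (walk-edge v i) (walk v i) (walk v (suc i))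
  walk-joins v i = edge-joins (μ (odd? i)) (walk v i)

  retreat : ∀ {b} v i → odd? i ≡ b → mate (μ b) (walk v (suc i)) ≡ walk v i
  retreat v i refl = mate-mate (μ (odd? i)) (walk v i)

  rewind-step : ∀ {u v} i j → odd? i ≡ odd? j → walk u (suc i) ≡ walk v (suc j) → walk u i ≡ walk v j
  rewind-step {u} {v} i j p eq =
    trans (sym (retreat u i p)) (trans (cong (mate (μ (odd? j))) eq) (retreat v j refl))

  -- Each step is an involution that depends only on the parity of its position. Two walks that meet
  -- in phase can thus be taken back together until the first is at its start.
  rewind : ∀ {u v} k i → walk u i ≡ walk v (i + 2 * k) → u ≡ walk v (2 * k)
  rewind k zero    eq = eq
  rewind k (suc i) eq = rewind k i (rewind-step i (i + 2 * k) (sym (odd?-+2* i k)) eq)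

  -- If two positions of different parity carried the same vertex, then so
  -- would the two positions one step inside of them, and so on until two
  -- consecutive ones.
  odd-gap-+ : ∀ {v} n {i j} → i + n ≡ j → odd? i ≢ odd? j → walk v i ≢ walk v j
  odd-gap-+ zero {i} refl p≢q eq = p≢q (cong odd? (sym (+-identityʳ i)))
  odd-gap-+ {v} (suc zero) {i} refl p≢q eq rewrite +-comm i 1 = mate≢ (μ (odd? i)) (walk v i) eq
  odd-gap-+ {v} (suc (suc n)) {i} refl p≢q eq rewrite +-suc i (suc n) =
    -- As the parities differ, the step leaving the first position and the step entering the second
    -- use the same matching.
    odd-gap-+ n (sym (+-suc i n))
      (λ p≡q → p≢q (trans (sym (not-involutive _)) (cong not p≡q)))
      (trans (cong (mate (μ (odd? i))) eq)
        (retreat v (i + suc n) (sym (trans (¬-not p≢q) (not-involutive _)))))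

  odd-gap : ∀ {v} i j → odd? i ≢ odd? j → walk v i ≢ walk v j
  odd-gap i j p≢q with ≤-total i j
  ... | inj₁ i≤j = odd-gap-+ (j ∸ i) {i} {j} (m+[n∸m]≡n i≤j) p≢q
  ... | inj₂ j≤i = λ eq → odd-gap-+ (i ∸ j) {j} {i} (m+[n∸m]≡n j≤i) (λ q≡p → p≢q (sym q≡p)) (sym eq)

  -- By `odd-gap` a repetition occurs at an even distance, and rewinding carries it back to the
  -- start: the walk is periodic from the beginning.
  repeat⇒return : ∀ {v i j} → i < j → walk v i ≡ walk v j →
                  ∃ λ m → j ≡ i + 2 * suc m × walk v (2 + 2 * m) ≡ v
  repeat⇒return {v} {i} {j} i<j eq with odd? i Bool.≟ odd? j
  ... | no p≢q = contradiction eq (odd-gap i j p≢q)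
  ... | yes p≡q with even-difference i<j p≡q
  ... | m , refl = m , refl , sym (trans (rewind (suc m) i eq) (cong (walk v) (*-suc 2 m)))

  returns : ∀ {n} → V G ↔ Fin n → ∀ v → ∃ λ m → walk v (2 + 2 * m) ≡ v
  returns {n} V↔Fin v with pigeonhole (n<1+n n) (Inverse.to V↔Fin ∘ walk v ∘ toℕ)
  ... | _ , _ , i<j , eq with repeat⇒return {v} i<j (Injection.injective (↔⇒↣ V↔Fin) eq)
  ... | m , _ , back = m , back

-- Alternating cycles

alternate : {G : Graph} → Matching G → Matching G → Bool → Matching G
alternate M N false = M
alternate M N true  = N

-- The cycle is unrolled into periodic sequences on ℕ, so that an arc may run past the starting
-- point; vertices are distinct in every window of `len` positions. `side-step` tells apart the two
-- sides of a cycle of length two. Closure under `M` is the form in which alternation enters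
-- conformality.
record AlternatingCycle {G : Graph} (M : Matching G) : Set where
  field
    m : ℕ

  len : ℕ
  len = 2 + 2 * m

  field
    vertex      : ℕ → V G
    side        : ℕ → E G
    side-joins  : ∀ i → Joins G (side i) (vertex i) (vertex (suc i))
    vertex-+len : ∀ i → vertex (i + len) ≡ vertex i
    side-+len   : ∀ i → side (i + len) ≡ side i
    vertex-inj  : ∀ {i j} → i < j → j < i + len → vertex i ≢ vertex j
    side-step   : ∀ i → side i ≢ side (suc i)
    vertex-mate : ∀ i → ∃ λ j → vertex j ≡ mate M (vertex i)

-- If the edges agreed at the mate, the common edge would lead back to `v` and so be the `Q`-edge at
-- `v` too.
edges-differ-mate : ∀ {G} (P Q : Matching G) {v} → edge P v ≢ edge Q v →
                    edge P (mate P v) ≢ edge Q (mate P v)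
edges-differ-mate {G} P Q {v} P≢Q eq = P≢Q (trans (sym (edge-mate P v)) (trans eq (sym (edge-shared Q
  (subst (λ e → Incident G e v) (trans (sym (edge-mate P v)) eq) (edge-incident P v))))))

module _ {G : Graph} {n : ℕ} (V↔Fin : V G ↔ Fin n) (M N : Matching G)
         {v : V G} (M≢N : edge M v ≢ edge N v) where

  private
    μ = alternate M N
    open Walk μ

    edges-differ : ∀ i → edge (μ (odd? i)) (walk v i) ≢ edge (μ (odd? (suc i))) (walk v i)
    edges-differ zero    = M≢N
    edges-differ (suc i)
      rewrite not-involutive (odd? i) =
      edges-differ-mate (μ (odd? i)) (μ (not (odd? i))) (edges-differ i) ∘ sym

    return : ∃ λ m → walk v (2 + 2 * m) ≡ v × (∀ {i} → i < m → walk v (2 + 2 * i) ≢ v)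
    return = least (λ m → ↔Fin⇒≟ V↔Fin (walk v (2 + 2 * m)) v) (proj₁ (returns V↔Fin v)) (proj₂ (returns V↔Fin v))

    walk-+len : ∀ m → walk v (2 + 2 * m) ≡ v → ∀ i → walk v (i + (2 + 2 * m)) ≡ walk v i
    walk-+len m back zero = back
    walk-+len m back (suc i) rewrite odd?-+[2+2*] i m = cong (mate (μ (odd? i))) (walk-+len m back i)

  -- The walk from `v` is cut at its first return. That the two matchings differ at `v` propagates
  -- along the walk, so no side is followed by itself.
  alternatingCycle : AlternatingCycle M
  alternatingCycle with return
  ... | m , back , first = record
    { m = m
    ; vertex = walk v
    ; side = walk-edge v
    ; side-joins = walk-joins v
    ; vertex-+len = walk-+len m back
    ; side-+len = λ i → cong₂ (λ b → edge (μ b)) (odd?-+[2+2*] i m) (walk-+len m back i)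
    ; vertex-inj = vertex-inj
    ; side-step = λ i eq → edges-differ-mate (μ (odd? i)) (μ (not (odd? i))) (edges-differ i) (trans (edge-mate (μ (odd? i)) (walk v i)) eq)
    ; vertex-mate = vertex-mate
    }
    where
    vertex-inj : ∀ {i j} → i < j → j < i + (2 + 2 * m) → walk v i ≢ walk v j
    -- A repetition within one round would make the start recur earlier, against the choice of `m`.
    vertex-inj {i} i<j j<i+len eq with repeat⇒return {v} i<j eq
    ... | m′ , refl , back′ = first (*-cancelˡ-< 2 m′ m (s≤s⁻¹ (s≤s⁻¹
      (subst (_< 2 + 2 * m) (*-suc 2 m′) (+-cancelˡ-< i (2 * suc m′) (2 + 2 * m) j<i+len))))) back′

    vertex-mate : ∀ i → ∃ λ j → walk v j ≡ mate M (walk v i)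
    -- `M` leads from an even position to the next one and from an odd position to the previous one.
    vertex-mate i with odd? i in eq
    vertex-mate i       | false = suc i , cong (λ b → mate (μ b) (walk v i)) eq
    vertex-mate (suc i) | true  = i , sym (retreat v i (not-injective eq))

module CycleProperties {G : Graph} (_≟V_ : DecidableEquality (V G)) (_≟E_ : DecidableEquality (E G))
                       {M : Matching G} (C : AlternatingCycle M) where
  open AlternatingCycle C

  OnCycle : V G → Set
  OnCycle v = ∃ λ i → i < len × vertex i ≡ v

  onCycle? : ∀ v → Dec (OnCycle v)
  onCycle? v = anyUpTo? (λ i → vertex i ≟V v) len

  Side : E G → Set
  Side e = ∃ λ i → i < len × side i ≡ e

  side? : ∀ e → Dec (Side e)
  side? e = anyUpTo? (λ i → side i ≟E e) len

  reduce : {A : Set} (f : ℕ → A) → (∀ i → f (i + len) ≡ f i) → ∀ i → ∃ λ j → j < len × f j ≡ f i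
  reduce f periodic i = i % len , m%n<n i len , sym (trans (cong f (m≡m%n+[m/n]*n i len)) (wrap (i / len)))
    where
    wrap : ∀ k → f (i % len + k * len) ≡ f (i % len)
    wrap zero    = cong f (+-identityʳ _)
    wrap (suc k) = trans (cong f (trans (cong (i % len +_) (+-comm len (k * len))) (sym (+-assoc (i % len) (k * len) len))))
                         (trans (periodic _) (wrap k))

  onCycle : ∀ i → OnCycle (vertex i)
  onCycle = reduce vertex vertex-+len

  isSide : ∀ i → Side (side i)
  isSide = reduce side side-+len

  onCycle-mate : ∀ {v} → OnCycle v → OnCycle (mate M v)
  onCycle-mate (i , _ , refl) with vertex-mate i
  ... | j , eq = subst OnCycle eq (onCycle j)

  side-incident : ∀ {e v} → Side e → Incident G e v → OnCycle v
  side-incident (i , _ , refl) e∼v with incident-joins {G} (side-joins i) e∼v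
  ... | inj₁ refl = onCycle i
  ... | inj₂ refl = onCycle (suc i)

  vertex-injective : ∀ {p i j} → p ≤ i → i < p + len → p ≤ j → j < p + len → vertex i ≡ vertex j → i ≡ j
  vertex-injective {p} {i} {j} p≤i i< p≤j j< eq with <-cmp i j
  ... | tri≈ _ i≡j _ = i≡j
  ... | tri< i<j _ _ = contradiction eq (vertex-inj i<j (<-≤-trans j< (+-monoˡ-≤ len p≤i)))
  ... | tri> _ _ j<i = contradiction (sym eq) (vertex-inj j<i (<-≤-trans i< (+-monoˡ-≤ len p≤j)))

  window : ∀ {p v} → p < len → OnCycle v → ∃ λ i → p ≤ i × i < p + len × vertex i ≡ v
  window {p} p<len (i , i<len , eq) with p ≤? i
  ... | yes p≤i = i , p≤i , <-≤-trans i<len (m≤n+m len p) , eq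
  ... | no  p≰i = i + len , ≤-trans (<⇒≤ p<len) (m≤n+m len i) , +-monoˡ-< len (≰⇒> p≰i) , trans (vertex-+len i) eq

  -- The start of side `j` would be an end of side `i`. Within one round this leaves only
  -- `j = i + 1`, which `side-step` forbids.
  side-inj : ∀ {i j} → i < j → j < i + len → side i ≢ side j
  side-inj {i} {j} i<j j<i+len eq
    with incident-joins {G} (side-joins i) (subst (λ e → Incident G e (vertex j)) (sym eq) (joins⇒incident {G} (side-joins j)))
  ... | inj₁ j≡i = vertex-inj i<j j<i+len (sym j≡i)
  ... | inj₂ j≡1+i with m≤n⇒m<n∨m≡n i<j
  ... | inj₁ 1+i<j = vertex-inj 1+i<j (≤-trans j<i+len (n≤1+n _)) (sym j≡1+i)
  ... | inj₂ refl  = side-step i eq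

  side-incident-vertex : ∀ {i j} → 0 < i → i < len → j < len → Incident G (side j) (vertex i) → i ≡ j ⊎ i ≡ suc j
  side-incident-vertex {i} {j} 0<i i<len j<len inc with incident-joins {G} (side-joins j) inc
  ... | inj₁ eq = inj₁ (vertex-injective z≤n i<len z≤n j<len eq)
  ... | inj₂ eq with m≤n⇒m<n∨m≡n j<len
  ... | inj₁ 1+j<len = inj₂ (vertex-injective z≤n i<len z≤n 1+j<len eq)
  -- The last side ends at vertex 0, which `0 < i` excludes.
  ... | inj₂ 1+j≡len = contradiction (vertex-injective z≤n z<s z≤n i<len
          (sym (trans eq (trans (cong vertex 1+j≡len) (vertex-+len 0))))) (<⇒≢ 0<i)

-- Ears

module Ears {G : Graph} {n : ℕ} (V↔Fin : V G ↔ Fin n) (_≟E_ : DecidableEquality (E G))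
            {M : Matching G} (C : AlternatingCycle M) (L : Matching G) where
  open AlternatingCycle C
  open CycleProperties (↔Fin⇒≟ V↔Fin) _≟E_ C
  open Walk (alternate L M)

  -- Being of odd length, the walk both leaves and reaches the cycle by an edge of `L`. `departs`
  -- prevents an ear of a single edge from being a side of the cycle.
  record Ear (i j : ℕ) : Set where
    field
      half    : ℕ
      departs : ¬ Side (edge L (vertex i))
      arrives : walk (vertex i) (suc (2 * half)) ≡ vertex j
      avoids  : ∀ {t} → 0 < t → t ≤ 2 * half → ¬ OnCycle (walk (vertex i) t)

    -- A repetition would bring the walk back to its start, a vertex of the cycle, before the ear
    -- ends.
    internal-injective : ∀ {s t} → s < t → t ≤ 2 * half → walk (vertex i) s ≢ walk (vertex i) t
    internal-injective {s} s<t t≤ eq with repeat⇒return {vertex i} s<t eq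
    ... | k , refl , back = avoids z<s (≤-trans (≤-trans (≤-reflexive (sym (*-suc 2 k))) (m≤n+m (2 * suc k) s)) t≤)
            (subst OnCycle (sym back) (onCycle i))

    -- `M` pairs the internal vertices as 1 with 2, 3 with 4 and so on; their number is even, so
    -- none is left over.
    internal-mate : ∀ {t} → 0 < t → t ≤ 2 * half →
      ∃ λ t′ → 0 < t′ × t′ ≤ 2 * half × walk (vertex i) t′ ≡ mate M (walk (vertex i) t)
    internal-mate {t} 0<t t≤ with odd? t in p
    internal-mate {suc (suc t)} _ t≤ | false =
      suc t , z<s , ≤-trans (n≤1+n _) t≤ , sym (retreat (vertex i) (suc t) (not-injective p))
    internal-mate {t} 0<t t≤ | true with m≤n⇒m<n∨m≡n t≤
    ... | inj₁ t< = suc t , z<s , t< , cong (λ b → mate (alternate L M b) (walk (vertex i) t)) p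
    ... | inj₂ refl = contradiction (trans (sym p) (odd?-+2* 0 half)) λ ()

    -- An ear begins and ends with `L`, so that read backwards it is again an alternating walk
    -- beginning with `L`.
    reversed : ∀ t u → t + u ≡ suc (2 * half) → walk (vertex j) t ≡ walk (vertex i) u
    reversed zero    u refl = sym arrives
    reversed (suc t) u t+u≡ =
      trans (cong (mate (alternate L M (odd? t))) (reversed t (suc u) (trans (+-suc t u) t+u≡)))
            (retreat (vertex i) u (opposite t u (suc-injective t+u≡)))
      where
      opposite : ∀ t u → t + u ≡ 2 * half → odd? u ≡ odd? t
      opposite zero    u refl = odd?-+2* 0 half
      opposite (suc t) u eq =
        trans (sym (not-involutive _)) (cong not (opposite t (suc u) (trans (+-suc t u) eq)))

    ends-differ : vertex i ≢ vertex j
    ends-differ eq = odd-gap {vertex i} 0 (suc (2 * half)) (λ p → contradiction (trans p (cong not (odd?-+2* 0 half))) λ ()) (trans eq (sym arrives))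

  open Ear

  ear-sym : ∀ {i j} → Ear i j → Ear j i
  ear-sym {i} {j} P = record
    { half = half P
    ; departs = departs′
    ; arrives = reversed P (suc (2 * half P)) 0 (+-identityʳ _)
    ; avoids = λ {t} 0<t t≤ → avoids P (m<n⇒0<n∸m (s≤s t≤)) (≤-trans (∸-monoʳ-≤ (suc (2 * half P)) 0<t) ≤-refl)
                  ∘ subst OnCycle (reversed P t (suc (2 * half P) ∸ t) (m+[n∸m]≡n (≤-trans t≤ (n≤1+n _))))
    }
    where
    departs′ : ¬ Side (edge L (vertex j))
    departs′ s with half P in eq
    -- A single edge is the `L`-edge of both its ends.
    ... | zero = departs P (subst Side (trans (cong (edge L) (sym arrives′)) (edge-mate L (vertex i))) s)
      where
      arrives′ : mate L (vertex i) ≡ vertex j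
      arrives′ = trans (cong (λ h → walk (vertex i) (suc (2 * h))) (sym eq)) (arrives P)
    -- The `L`-mate of `vertex j` is the last internal vertex; if the edge were a side, that vertex
    -- would lie on the cycle.
    ... | suc h = avoids P {2 * half P} (≤-trans (s≤s z≤n) (≤-reflexive (sym (trans (cong (2 *_) eq) (*-suc 2 h))))) ≤-refl
      (subst OnCycle (reversed P 1 (2 * half P) refl)
        (side-incident s (joins⇒incident {G} (joins-sym {G} (edge-joins L (vertex j))))))

  -- Two ears that meet in phase have run together ever since they left
  -- the cycle.
  meet-in-phase : ∀ {i j k l} (P : Ear i j) (Q : Ear k l) → ∀ s t → odd? s ≡ odd? t →
    s ≤ 2 * half P → t ≤ 2 * half Q → walk (vertex i) s ≡ walk (vertex k) t → vertex i ≡ vertex k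
  meet-in-phase P Q zero zero _ _ _ eq = eq
  meet-in-phase {i} P Q zero (suc t) _ _ t≤ eq = contradiction (subst OnCycle eq (onCycle i)) (avoids Q z<s t≤)
  meet-in-phase {k = k} P Q (suc s) zero _ s≤ _ eq = contradiction (subst OnCycle (sym eq) (onCycle k)) (avoids P z<s s≤)
  meet-in-phase P Q (suc s) (suc t) p s≤ t≤ eq =
    meet-in-phase P Q s t (not-injective p) (≤-trans (n≤1+n s) s≤) (≤-trans (n≤1+n t) t≤)
      (rewind-step s t (not-injective p) eq)

  -- Ears meeting in phase have a common start. If they meet out of phase, reading `Q` backwards
  -- brings them into phase, its length being odd, and `P` starts where `Q` ends.
  ears-disjoint : ∀ {i j k l} (P : Ear i j) (Q : Ear k l) → vertex i ≢ vertex k → vertex i ≢ vertex l →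
    ∀ {s t} → s ≤ 2 * half P → 0 < t → t ≤ 2 * half Q → walk (vertex i) s ≢ walk (vertex k) t
  ears-disjoint P Q i≢k i≢l {s} {t} s≤ 0<t t≤ eq with odd? s Bool.≟ odd? t
  ... | yes p≡q = i≢k (meet-in-phase P Q s t p≡q s≤ t≤ eq)
  ... | no  p≢q = i≢l (meet-in-phase P (ear-sym Q) s (suc (2 * half Q) ∸ t) phase s≤ (∸-monoʳ-≤ (suc (2 * half Q)) 0<t)
      (trans eq (sym (reversed Q (suc (2 * half Q) ∸ t) t (m∸n+n≡m t≤1+)))))
    where
    t≤1+ : t ≤ suc (2 * half Q)
    t≤1+ = ≤-trans t≤ (n≤1+n _)
    complement : ∀ t u → t + u ≡ suc (2 * half Q) → odd? u ≡ not (odd? t)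
    complement zero    u refl = cong not (odd?-+2* 0 (half Q))
    complement (suc t) u eq   =
      trans (sym (not-involutive _)) (cong not (complement t (suc u) (trans (+-suc t u) eq)))
    phase : odd? s ≡ odd? (suc (2 * half Q) ∸ t)
    phase = trans (¬-not p≢q) (sym (complement t _ (m+[n∸m]≡n t≤1+)))

  -- The walk returns to its start, so it meets the cycle again. The first time, it cannot arrive by
  -- an edge of `M`: the cycle is closed under `M`, and the preceding vertex would already lie on
  -- it.
  ear : ∀ {i} → ¬ Side (edge L (vertex i)) → ∃ λ j → j < len × Ear i j
  ear {i} i∉ with returns V↔Fin (vertex i)
  ... | m , back with least {λ r → OnCycle (walk (vertex i) (suc r))} (λ r → onCycle? _) (suc (2 * m)) (subst OnCycle (sym back) (onCycle i))
  ... | r , (j , j<len , eq) , first with even-or-odd r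
  ... | inj₁ (h , refl) = j , j<len , record
    { half = h ; departs = i∉ ; arrives = sym eq ; avoids = λ { {suc t} _ → first } }
  ... | inj₂ (h , refl) = contradiction
    (subst OnCycle (trans (cong (mate M) eq) (retreat (vertex i) (suc (2 * h)) (cong not (odd?-+2* 0 h))))
      (onCycle-mate (onCycle j))) (first ≤-refl)

-- A cycle together with ears

-- Arc i of the cycle runs from `position i` to `position (suc i)`.  As Θ and K₄
-- are oriented acyclically, the arc that closes the cycle has to be read
-- backwards; `reverse` marks it.

module Layout {G : Graph} {n : ℕ} (V↔Fin : V G ↔ Fin n) (_≟E_ : DecidableEquality (E G))
              {M : Matching G} (C : AlternatingCycle M) (L : Matching G)
              (J : Graph) {c : ℕ} {I : Set} (searchI : Searchable I)
              (corners : V J ↔ Fin c) (pieces : E J ↔ (Fin c ⊎ I)) (reverse : Fin c → Bool)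
              {p : ℕ} (p<len : p < AlternatingCycle.len C) (arc-half : ℕ → ℕ) where

  open AlternatingCycle C
  open CycleProperties (↔Fin⇒≟ V↔Fin) _≟E_ C
  open Walk (alternate L M)
  open Ears V↔Fin _≟E_ C L
  open Ear

  piece : E J → Fin c ⊎ I
  piece = Inverse.to pieces

  realise : Fin c ⊎ I → E J
  realise = Inverse.from pieces

  -- Every arc has odd length, as a bi-subdivided edge must. The round starts at `p`, so positions
  -- may exceed `len`.
  position : ℕ → ℕ
  position zero    = p
  position (suc i) = suc (2 * arc-half i) + position i

  at : V J → ℕ
  at v = position (toℕ (Inverse.to corners v))

  module _
    (closes   : position c ≡ p + len)
    -- Vertices are compared rather than positions, because the closing arc reaches the first corner
    -- one round after `p`.
    (arc-src  : ∀ i → vertex (at (src J (realise (inj₁ i)))) ≡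
                      vertex (position (if reverse i then suc (toℕ i) else toℕ i)))
    (arc-tgt  : ∀ i → vertex (at (tgt J (realise (inj₁ i)))) ≡
                      vertex (position (if reverse i then toℕ i else suc (toℕ i))))
    (ears     : ∀ β → Ear (at (src J (realise (inj₂ β)))) (at (tgt J (realise (inj₂ β)))))
    (separate : ∀ β β′ → β ≡ β′ ⊎ (src J (realise (inj₂ β)) ≢ src J (realise (inj₂ β′)) ×
                                   src J (realise (inj₂ β)) ≢ tgt J (realise (inj₂ β′))))
    where

    offset : Bool → ℕ → ℕ → ℕ
    offset false s t = t
    offset true  s t = s ∸ t

    ear-src : I → V G
    ear-src β = vertex (at (src J (realise (inj₂ β))))

    piece-half : Fin c ⊎ I → ℕ
    piece-half (inj₁ i) = arc-half (toℕ i)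
    piece-half (inj₂ β) = half (ears β)

    piece-vertex : Fin c ⊎ I → ℕ → V G
    piece-vertex (inj₁ i) t = vertex (offset (reverse i) (suc (2 * arc-half (toℕ i))) t + position (toℕ i))
    piece-vertex (inj₂ β) t = walk (ear-src β) t

    -- A reversed arc counts its edges down from `2 * arc-half`, one less than for its vertices: the
    -- edge between two positions is named after the smaller.
    piece-edge : Fin c ⊎ I → ℕ → E G
    piece-edge (inj₁ i) t = side (offset (reverse i) (2 * arc-half (toℕ i)) t + position (toℕ i))
    piece-edge (inj₂ β) t = walk-edge (ear-src β) t

    piece-joins : ∀ x {t} → t ≤ 2 * piece-half x →
                  Joins G (piece-edge x t) (piece-vertex x t) (piece-vertex x (suc t))
    piece-joins (inj₁ i) {t} t≤ with reverse i
    ... | false = side-joins (t + position (toℕ i))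
    ... | true  = subst (λ o → Joins G (side (2 * arc-half (toℕ i) ∸ t + position (toℕ i))) (vertex (o + position (toℕ i)))
                                 (vertex (2 * arc-half (toℕ i) ∸ t + position (toℕ i))))
                    (sym (+-∸-assoc 1 t≤)) (joins-sym {G} (side-joins _))
    piece-joins (inj₂ β) {t} _ = walk-joins (ear-src β) t

    piece-src : ∀ x → vertex (at (src J (realise x))) ≡ piece-vertex x 0
    piece-src (inj₁ i) with reverse i | arc-src i
    ... | false | eq = eq
    ... | true  | eq = eq
    piece-src (inj₂ β) = refl

    piece-tgt : ∀ x → vertex (at (tgt J (realise x))) ≡ piece-vertex x (suc (2 * piece-half x))
    piece-tgt (inj₁ i) with reverse i | arc-tgt i
    ... | false | eq = eq
    ... | true  | eq = trans eq (cong (λ o → vertex (o + position (toℕ i))) (sym (n∸n≡0 (2 * arc-half (toℕ i)))))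
    piece-tgt (inj₂ β) = sym (arrives (ears β))

    offset-bounds : ∀ b s {t} → t < s → 0 < offset b (suc s) (suc t) × offset b (suc s) (suc t) ≤ s
    offset-bounds false s t<s = z<s , t<s
    offset-bounds true  s {t} t<s = m<n⇒0<n∸m t<s , m∸n≤m s t

    offset-involutive : ∀ b {s t} → t ≤ s → offset b s (offset b s t) ≡ t
    offset-involutive false t≤s = refl
    offset-involutive true  t≤s = m∸[m∸n]≡n t≤s

    offset-injective : ∀ b {s t u} → t ≤ s → u ≤ s → offset b s t ≡ offset b s u → t ≡ u
    offset-injective b {s} t≤s u≤s eq =
      trans (sym (offset-involutive b t≤s)) (trans (cong (offset b s) eq) (offset-involutive b u≤s))

    position-mono : ∀ {i j} → i ≤ j → position i ≤ position j
    position-mono {i} {zero}  z≤n = ≤-refl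
    position-mono {i} {suc j} i≤1+j with m≤n⇒m<n∨m≡n i≤1+j
    ... | inj₂ refl  = ≤-refl
    ... | inj₁ i<1+j = ≤-trans (position-mono (s≤s⁻¹ i<1+j)) (m≤n+m (position j) (suc (2 * arc-half j)))

    -- The half-open arcs tile one round from `p`, on which `vertex` is injective.
    rim-injective : ∀ {i j o o′} → i < c → j < c → o ≤ 2 * arc-half i → o′ ≤ 2 * arc-half j →
      vertex (o + position i) ≡ vertex (o′ + position j) → i ≡ j × o ≡ o′
    rim-injective {i} {j} {o} {o′} i<c j<c o≤ o′≤ eq with
      vertex-injective (above i o) (below i<c o≤) (above j o′) (below j<c o′≤) eq
      where
      above : ∀ i o → p ≤ o + position i
      above i o = ≤-trans (position-mono {0} {i} z≤n) (m≤n+m (position i) o)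
      below : ∀ {i o} → i < c → o ≤ 2 * arc-half i → o + position i < p + len
      below {i} {o} i<c o≤ = <-≤-trans (+-monoˡ-< (position i) (s≤s o≤))
        (≤-trans (position-mono i<c) (≤-reflexive closes))
    ... | same with <-cmp i j
    ... | tri≈ _ refl _ = refl , +-cancelʳ-≡ (position i) o o′ same
    ... | tri< i<j _ _ = contradiction same (<⇒≢ (<-≤-trans (+-monoˡ-< (position i) (s≤s o≤))
                           (≤-trans (position-mono i<j) (m≤n+m (position j) o′))))
    ... | tri> _ _ j<i = contradiction (sym same) (<⇒≢ (<-≤-trans (+-monoˡ-< (position j) (s≤s o′≤))
                           (≤-trans (position-mono j<i) (m≤n+m (position i) o))))

    at-injective : ∀ {u v} → vertex (at u) ≡ vertex (at v) → u ≡ v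
    at-injective {u} {v} eq = Injection.injective (↔⇒↣ corners)
      (toℕ-injective (proj₁ (rim-injective (toℕ<n _) (toℕ<n _) z≤n z≤n eq)))

    corner≢internal : ∀ v x {t} → t < 2 * piece-half x → vertex (at v) ≢ piece-vertex x (suc t)
    corner≢internal v (inj₁ i) t< eq with offset-bounds (reverse i) (2 * arc-half (toℕ i)) t<
    ... | 0<o , o≤ = <⇒≢ 0<o (proj₂ (rim-injective (toℕ<n (Inverse.to corners v)) (toℕ<n i) z≤n o≤ eq))
    corner≢internal v (inj₂ β) t< eq = avoids (ears β) z<s t< (subst OnCycle eq (onCycle (at v)))

    internal-unique : ∀ x y {t u} → t < 2 * piece-half x → u < 2 * piece-half y →
      piece-vertex x (suc t) ≡ piece-vertex y (suc u) → x ≡ y × t ≡ u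
    internal-unique (inj₁ i) (inj₁ j) t< u< eq with rim-injective (toℕ<n i) (toℕ<n j)
      (proj₂ (offset-bounds (reverse i) (2 * arc-half (toℕ i)) t<))
      (proj₂ (offset-bounds (reverse j) (2 * arc-half (toℕ j)) u<)) eq
    ... | i≡j , o≡o′ with refl ← toℕ-injective i≡j =
      refl , suc-injective (offset-injective (reverse i) (s≤s (<⇒≤ t<)) (s≤s (<⇒≤ u<)) o≡o′)
    internal-unique (inj₁ i) (inj₂ β) t< u< eq = contradiction (subst OnCycle eq (onCycle _)) (avoids (ears β) z<s u<)
    internal-unique (inj₂ β) (inj₁ i) t< u< eq = contradiction (subst OnCycle (sym eq) (onCycle _)) (avoids (ears β) z<s t<)
    internal-unique (inj₂ β) (inj₂ β′) {t} {u} t< u< eq with separate β β′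
    ... | inj₂ (s≢s′ , s≢t′) =
      contradiction eq (ears-disjoint (ears β) (ears β′) (s≢s′ ∘ at-injective) (s≢t′ ∘ at-injective) t< z<s u<)
    ... | inj₁ refl with <-cmp t u
    ... | tri≈ _ t≡u _ = refl , t≡u
    ... | tri< t<u _ _ = contradiction eq (internal-injective (ears β) (s≤s t<u) u<)
    ... | tri> _ _ u<t = contradiction (sym eq) (internal-injective (ears β) (s≤s u<t) t<)

    h : E J → ℕ
    h e = piece-half (piece e)

    S : Graph
    S = subdivide J (λ e → 2 * h e)

    f : V S → V G
    f (inj₁ v)       = vertex (at v)
    f (inj₂ (e , t)) = piece-vertex (piece e) (suc (toℕ t))

    g : E S → E G
    g (e , t) = piece-edge (piece e) (toℕ t)

    f-injective : ∀ {s s′} → f s ≡ f s′ → s ≡ s′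
    f-injective {inj₁ u} {inj₁ v} eq = cong inj₁ (at-injective eq)
    f-injective {inj₁ u} {inj₂ (e , t)} eq = contradiction eq (corner≢internal u (piece e) (toℕ<n t))
    f-injective {inj₂ (e , t)} {inj₁ u} eq = contradiction (sym eq) (corner≢internal u (piece e) (toℕ<n t))
    f-injective {inj₂ (e , t)} {inj₂ (e′ , t′)} eq
      with internal-unique (piece e) (piece e′) (toℕ<n t) (toℕ<n t′) eq
    ... | x≡y , t≡t′ with refl ← Injection.injective (↔⇒↣ pieces) x≡y
                     with refl ← toℕ-injective t≡t′ = refl

    f-before : ∀ e i → f (before J (λ e → 2 * h e) e i) ≡ piece-vertex (piece e) (toℕ i)
    f-before e zero = trans (cong (vertex ∘ at ∘ src J) (sym (Inverse.strictlyInverseʳ pieces e))) (piece-src (piece e))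
    f-before e (suc i) = refl

    f-after : ∀ e i → f (after J (λ e → 2 * h e) e i) ≡ piece-vertex (piece e) (suc (toℕ i))
    f-after e i with view i
    ... | ‵fromℕ = trans (cong (vertex ∘ at ∘ tgt J) (sym (Inverse.strictlyInverseʳ pieces e)))
                     (trans (piece-tgt (piece e)) (cong (λ k → piece-vertex (piece e) (suc k)) (sym (toℕ-fromℕ _))))
    ... | ‵inject₁ j = cong (λ k → piece-vertex (piece e) (suc k)) (sym (toℕ-inject₁ j))

    g-joins : ∀ s → Joins G (g s) (f (src S s)) (f (tgt S s))
    g-joins (e , i) rewrite f-before e i | f-after e i = piece-joins (piece e) (s≤s⁻¹ (toℕ<n i))

    -- The counterpart of `rim-injective`: the tiling leaves no gap.
    cell : ∀ k {x} → p ≤ x → x < position k →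
           ∃ λ i → i < k × ∃ λ o → o ≤ 2 * arc-half i × x ≡ o + position i
    cell zero p≤x x< = contradiction p≤x (<⇒≱ x<)
    cell (suc k) {x} p≤x x< with x <? position k
    ... | yes x<′ with cell k p≤x x<′
    ... | i , i<k , rest = i , ≤-trans i<k (n≤1+n k) , rest
    cell (suc k) {x} p≤x x< | no x≮ =
      k , ≤-refl , x ∸ position k ,
      s≤s⁻¹ (+-cancelʳ-< (position k) _ _ (subst (_< suc (2 * arc-half k) + position k) (sym x≡) x<)) , sym x≡
      where
      x≡ : x ∸ position k + position k ≡ x
      x≡ = m∸n+n≡m (≮⇒≥ x≮)

    -- As `offset` is an involution, the place of a vertex on a reversed arc is found by reversing
    -- its offset once more.
    arc-vertex : ∀ (i : Fin c) {o} → o < 2 * arc-half (toℕ i) →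
      ∃ λ (t : Fin (2 * arc-half (toℕ i))) → piece-vertex (inj₁ i) (suc (toℕ t)) ≡ vertex (suc o + position (toℕ i))
    arc-vertex i {o} o< with offset (reverse i) (suc (2 * arc-half (toℕ i))) (suc o)
                           | offset-bounds (reverse i) (2 * arc-half (toℕ i)) o<
                           | offset-involutive (reverse i) {suc (2 * arc-half (toℕ i))} (s≤s (<⇒≤ o<))
    ... | suc t | _ , t< | inv = fromℕ< t< , cong (λ o → vertex (o + position (toℕ i)))
      (trans (cong (λ t → offset (reverse i) (suc (2 * arc-half (toℕ i))) (suc t)) (toℕ-fromℕ< t<)) inv)

    locate : ∀ {v} → OnCycle v → ∃ λ s → f s ≡ v
    locate v∈ with window p<len v∈
    ... | x , p≤x , x< , refl with cell c p≤x (subst (x <_) (sym closes) x<)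
    ... | i , i<c , zero , _ , refl = inj₁ (Inverse.from corners (fromℕ< i<c)) ,
      cong (vertex ∘ position) (trans (cong toℕ (Inverse.strictlyInverseˡ corners (fromℕ< i<c))) (toℕ-fromℕ< i<c))
    ... | i , i<c , suc o , o< , refl with fromℕ< i<c | toℕ-fromℕ< i<c
    -- `piece (realise (inj₁ i′))` equals `inj₁ i′` only propositionally, hence the transport.
    ... | i′ | refl with subst (λ x → ∃ λ (t : Fin (2 * piece-half x)) → piece-vertex x (suc (toℕ t)) ≡ vertex (suc o + position (toℕ i′)))
                          (sym (Inverse.strictlyInverseˡ pieces (inj₁ i′))) (arc-vertex i′ o<)
    ... | t , eq = inj₂ (realise (inj₁ i′) , t) , eq

    internal-closed : ∀ x (t : Fin (2 * piece-half x)) →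
      OnCycle (mate M (piece-vertex x (suc (toℕ t)))) ⊎
      ∃ λ (t′ : Fin (2 * piece-half x)) → piece-vertex x (suc (toℕ t′)) ≡ mate M (piece-vertex x (suc (toℕ t)))
    internal-closed (inj₁ i) t = inj₁ (onCycle-mate (onCycle _))
    internal-closed (inj₂ β) t with internal-mate (ears β) z<s (toℕ<n t)
    ... | suc t′ , _ , t′< , eq = inj₂ (fromℕ< t′< , trans (cong (λ t → walk (ear-src β) (suc t)) (toℕ-fromℕ< t′<)) eq)

    -- The cycle is closed under `M` and exhausted by the arcs; the internal vertices of an ear are
    -- paired among themselves.
    f-closed : ∀ s → ∃ λ s′ → f s′ ≡ mate M (f s)
    f-closed (inj₁ v) = locate (onCycle-mate (onCycle (at v)))
    f-closed (inj₂ (e , t)) with internal-closed (piece e) t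
    ... | inj₁ onC       = locate onC
    ... | inj₂ (t′ , eq) = inj₂ (e , t′) , eq

    -- What remains for the caller is that parallel edges of `J` begin with different edges of `G`.
    -- This is an issue for `Θ`, while `K₄` is simple.
    layout : (∀ e e′ → piece-edge (piece e) 0 ≡ piece-edge (piece e′) 0 → Joins J e (src J e′) (tgt J e′) → e ≡ e′) →
             J IsConformalMinorOf G
    layout parallel = Embedding.conformalMinor (↔Fin⇒≟ V↔Fin) _≟E_ (search-↔ corners any?)
      (search-↔ pieces (search-⊎ any? searchI)) M h f f-injective g g-joins parallel f-closed

-- Θ and K₄ as cycles with one ear and with two crossing ears

complete-simple : ∀ {n} (e e′ : E (complete n)) →
                  Joins (complete n) e (src (complete n) e′) (tgt (complete n) e′) → e ≡ e′
complete-simple (i , j , i<j) (_ , _ , i<j′) (inj₁ (refl , refl)) = cong (λ p → i , j , p) (<-irrelevant i<j i<j′)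
complete-simple (i , j , i<j) (_ , _ , j<i)  (inj₂ (refl , refl)) = contradiction i<j (<-asym j<i)

Θ-pieces : E Θ ↔ (Fin 2 ⊎ Fin 1)
Θ-pieces = mk↔ₛ′
  (λ { zero → inj₁ zero ; (suc zero) → inj₁ (suc zero) ; (suc (suc zero)) → inj₂ zero })
  (λ { (inj₁ zero) → zero ; (inj₁ (suc zero)) → suc zero ; (inj₂ zero) → suc (suc zero) })
  (λ { (inj₁ zero) → refl ; (inj₁ (suc zero)) → refl ; (inj₂ zero) → refl })
  (λ { zero → refl ; (suc zero) → refl ; (suc (suc zero)) → refl })

-- The rim is the 4-cycle 0, 1, 2, 3, and the ears are the diagonals 02 and 13. The edge 03 is
-- oriented against the rim.
K₄-pieces : E K₄ ↔ (Fin 4 ⊎ Fin 2)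
K₄-pieces = mk↔ₛ′ to from
  (λ { (inj₁ zero) → refl ; (inj₁ (suc zero)) → refl ; (inj₁ (suc (suc zero))) → refl
     ; (inj₁ (suc (suc (suc zero)))) → refl ; (inj₂ zero) → refl ; (inj₂ (suc zero)) → refl })
  from-to
  where
  pattern 0F = zero
  pattern 1F = suc zero
  pattern 2F = suc (suc zero)
  pattern 3F = suc (suc (suc zero))

  to : E K₄ → Fin 4 ⊎ Fin 2
  to (0F , 1F , _) = inj₁ 0F
  to (1F , 2F , _) = inj₁ 1F
  to (2F , 3F , _) = inj₁ 2F
  to (0F , 3F , _) = inj₁ 3F
  to (0F , 2F , _) = inj₂ 0F
  to (1F , 3F , _) = inj₂ 1F
  to (_  , 0F , ())
  to (1F , 1F , s≤s ())
  to (2F , 1F , s≤s ())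
  to (2F , 2F , s≤s (s≤s ()))
  to (3F , 1F , s≤s ())
  to (3F , 2F , s≤s (s≤s ()))
  to (3F , 3F , s≤s (s≤s (s≤s ())))

  from : Fin 4 ⊎ Fin 2 → E K₄
  from (inj₁ 0F) = 0F , 1F , s≤s z≤n
  from (inj₁ 1F) = 1F , 2F , s≤s (s≤s z≤n)
  from (inj₁ 2F) = 2F , 3F , s≤s (s≤s (s≤s z≤n))
  from (inj₁ 3F) = 0F , 3F , s≤s z≤n
  from (inj₂ 0F) = 0F , 2F , s≤s z≤n
  from (inj₂ 1F) = 1F , 3F , s≤s (s≤s z≤n)

  from-to : ∀ e → from (to e) ≡ e
  from-to (0F , 1F , s≤s z≤n) = refl
  from-to (1F , 2F , s≤s (s≤s z≤n)) = refl
  from-to (2F , 3F , s≤s (s≤s (s≤s z≤n))) = refl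
  from-to (0F , 3F , s≤s z≤n) = refl
  from-to (0F , 2F , s≤s z≤n) = refl
  from-to (1F , 3F , s≤s (s≤s z≤n)) = refl
  from-to (_  , 0F , ())
  from-to (1F , 1F , s≤s ())
  from-to (2F , 1F , s≤s ())
  from-to (2F , 2F , s≤s (s≤s ()))
  from-to (3F , 1F , s≤s ())
  from-to (3F , 2F , s≤s (s≤s ()))
  from-to (3F , 3F , s≤s (s≤s (s≤s ())))

-- Minors from ears, and the descent on their span

module Minors {G : Graph} {n : ℕ} (V↔Fin : V G ↔ Fin n) (_≟E_ : DecidableEquality (E G))
              {M : Matching G} (C : AlternatingCycle M) (L : Matching G) where
  open AlternatingCycle C
  open CycleProperties (↔Fin⇒≟ V↔Fin) _≟E_ C
  open Ears V↔Fin _≟E_ C L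
  open Ear

  -- For the arc that closes the cycle: from the last corner to the first corner one round later.
  odd?-≢-+len : ∀ {i j} → odd? i ≢ odd? j → odd? j ≢ odd? (i + len)
  odd?-≢-+len {i} p≢q eq = p≢q (sym (trans eq (odd?-+[2+2*] i m)))

  -- Ends of different parity split the even cycle into two odd arcs, which together with the ear
  -- are the three edges of `Θ`.
  theta : ∀ {i j} → i < j → j < len → odd? i ≢ odd? j → Ear i j → Θ IsConformalMinorOf G
  theta {i} {j} i<j j<len p≢q P
    with odd-difference i<j p≢q | odd-difference (<-≤-trans j<len (m≤n+m len i)) (odd?-≢-+len {i} {j} p≢q)
  ... | a , refl | b , closes =
    Layout.layout V↔Fin _≟E_ C L Θ any? (↔-id (Fin 2)) Θ-pieces
      (λ { zero → false ; (suc zero) → true }) (<-trans i<j j<len) (λ { zero → a ; (suc _) → b })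
      (sym closes)
      (λ { zero → refl ; (suc zero) → closing })
      (λ { zero → refl ; (suc zero) → refl })
      (λ { zero → P })
      (λ { zero zero → inj₁ refl })
      parallel
    where
    closing : vertex i ≡ vertex (suc (2 * b) + (suc (2 * a) + i))
    closing = trans (sym (vertex-+len i)) (cong vertex closes)

    -- The closing arc is read backwards, so its first edge is the side just before the round
    -- closes. From the ear both arcs differ by `departs`.
    last≢first : side (2 * b + (suc (2 * a) + i)) ≢ side i
    last≢first eq = side-step _ (trans eq (trans (sym (side-+len i)) (cong side closes)))

    parallel : ∀ e e′ → _ → _ → e ≡ e′
    parallel zero zero _ _ = refl
    parallel zero (suc zero) eq _ = contradiction (sym eq) last≢first
    parallel zero (suc (suc zero)) eq _ = contradiction (subst Side eq (isSide _)) (departs P)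
    parallel (suc zero) zero eq _ = contradiction eq last≢first
    parallel (suc zero) (suc zero) _ _ = refl
    parallel (suc zero) (suc (suc zero)) eq _ = contradiction (subst Side eq (isSide _)) (departs P)
    parallel (suc (suc zero)) zero eq _ = contradiction (subst Side (sym eq) (isSide _)) (departs P)
    parallel (suc (suc zero)) (suc zero) eq _ = contradiction (subst Side (sym eq) (isSide _)) (departs P)
    parallel (suc (suc zero)) (suc (suc zero)) _ _ = refl

  -- The corners `i`, `k`, `j`, `l` alternate in parity, so all four arcs are odd and form the rim;
  -- the crossing ears are the diagonals.
  k4 : ∀ {i k j l} → i < k → k < j → j < l → l < len → odd? i ≡ odd? j → odd? k ≡ odd? l → odd? i ≢ odd? k →
       Ear i j → Ear k l → K₄ IsConformalMinorOf G
  k4 {i} {k} {j} {l} i<k k<j j<l l<len i≡j k≡l i≢k P Q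
    with odd-difference i<k i≢k
       | odd-difference k<j (λ k≡j → i≢k (trans i≡j (sym k≡j)))
       | odd-difference j<l (λ j≡l → i≢k (trans i≡j (trans j≡l (sym k≡l))))
       | odd-difference (<-≤-trans l<len (m≤n+m len i)) (odd?-≢-+len {i} {l} (λ i≡l → i≢k (trans i≡l (sym k≡l))))
  ... | a , refl | b , refl | c , refl | d , closes =
    Layout.layout V↔Fin _≟E_ C L K₄ any? (↔-id (Fin 4)) K₄-pieces
      (λ { (suc (suc (suc zero))) → true ; _ → false }) (<-trans i<k (<-trans k<j (<-trans j<l l<len)))
      (λ { zero → a ; (suc zero) → b ; (suc (suc zero)) → c ; (suc (suc (suc _))) → d })
      (sym closes)
      (λ { zero → refl ; (suc zero) → refl ; (suc (suc zero)) → refl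
         ; (suc (suc (suc zero))) → trans (sym (vertex-+len i)) (cong vertex closes) })
      (λ { zero → refl ; (suc zero) → refl ; (suc (suc zero)) → refl ; (suc (suc (suc zero))) → refl })
      (λ { zero → P ; (suc zero) → Q })
      (λ { zero zero → inj₁ refl ; zero (suc zero) → inj₂ ((λ ()) , (λ ()))
         ; (suc zero) zero → inj₂ ((λ ()) , (λ ())) ; (suc zero) (suc zero) → inj₁ refl })
      (λ e e′ _ → complete-simple e e′)

  on-matching : ∀ {u v e} → edge L u ≡ e → Incident G e v → edge L v ≡ e
  on-matching refl = edge-shared L

  side-head : ∀ i → Incident G (side i) (vertex i)
  side-head i = joins⇒incident {G} (side-joins i)

  side-tail : ∀ i → Incident G (side i) (vertex (suc i))
  side-tail i = joins⇒incident {G} (joins-sym {G} (side-joins i))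

  -- Otherwise L would pair the vertices strictly between the two ends in
  -- consecutive couples, although their number is odd.
  departure-between : ∀ {i j} → i < j → j < len → odd? i ≡ odd? j → Ear i j →
    ∃ λ k → i < k × k < j × odd? i ≢ odd? k × ¬ Side (edge L (vertex k))
  departure-between {i} {j} i<j j<len i≡j P =
    go j i ≤-refl i<j (m≤m+n j i) refl
      λ eq → departs P (subst Side (sym (on-matching eq (side-head i))) (isSide i))
    where
    -- `x` runs through positions of the parity of `i`. The last hypothesis says that vertex `x + 1`
    -- is not paired backwards by `side x`, so its `L`-edge either departs or is `side (x + 1)`.
    go : ∀ fuel x → i ≤ x → x < j → j ≤ fuel + x → odd? i ≡ odd? x → edge L (vertex (suc x)) ≢ side x →
         ∃ λ k → i < k × k < j × odd? i ≢ odd? k × ¬ Side (edge L (vertex k))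
    go zero x i≤x x<j j≤x _ _ = contradiction x<j (≤⇒≯ j≤x)
    go (suc fuel) x i≤x x<j j≤ i≡x unpaired with m≤n⇒m<n∨m≡n x<j
    ... | inj₂ refl = contradiction (trans (sym i≡x) i≡j) (not-¬ refl)
    ... | inj₁ 1+x<j with side? (edge L (vertex (suc x)))
    ... | no departing = suc x , s≤s i≤x , 1+x<j , (λ eq → not-¬ refl (trans (sym i≡x) eq)) , departing
    ... | yes (y , y<len , y≡) with side-incident-vertex z<s (<-trans 1+x<j j<len) y<len
                                      (subst (λ e → Incident G e (vertex (suc x))) (sym y≡) (edge-incident L _))
    ... | inj₂ refl = contradiction (sym y≡) unpaired
    ... | inj₁ refl with m≤n⇒m<n∨m≡n 1+x<j
    -- A couple ending at `j` would make a side of the `L`-edge by which the ear arrives.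
    ... | inj₂ refl = contradiction (subst Side (sym (on-matching (sym y≡) (side-tail (suc x)))) (isSide (suc x)))
                        (departs (ear-sym P))
    ... | inj₁ 2+x<j = go fuel (2 + x) (≤-trans i≤x (m≤n+m x 2)) 2+x<j
      (≤-trans j≤ (≤-trans (≤-reflexive (sym (+-suc fuel x))) (+-monoʳ-≤ fuel (n≤1+n (suc x)))))
      (trans i≡x (sym (not-involutive _)))
      -- Vertex `x + 2` is already paired backwards; pairing it forwards too would identify two
      -- consecutive sides.
      λ eq → side-step (suc x) (trans (sym (on-matching (sym y≡) (side-tail (suc x)))) (on-matching eq (side-head (2 + x))))

  -- Descent on `n`, which bounds the distance `j - i` of the ends.
  minor : ∀ n {i j} → i < j → j ≤ n + i → j < len → Ear i j → (Θ IsConformalMinorOf G) ⊎ (K₄ IsConformalMinorOf G)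
  minor zero i<j j≤i _ _ = contradiction i<j (≤⇒≯ j≤i)
  minor (suc n) {i} {j} i<j j≤ j<len P with odd? i Bool.≟ odd? j
  ... | no  i≢j = inj₁ (theta i<j j<len i≢j P)
  ... | yes i≡j with departure-between i<j j<len i≡j P
  ... | k , i<k , k<j , i≢k , departing with ear {k} departing
  ... | l , l<len , Q with odd? k Bool.≟ odd? l
  ... | no k≢l with <-cmp k l
  ... | tri< k<l _ _ = inj₁ (theta k<l l<len k≢l Q)
  ... | tri≈ _ refl _ = contradiction refl k≢l
  ... | tri> _ _ l<k = inj₁ (theta l<k (<-trans k<j j<len) (k≢l ∘ sym) (ear-sym Q))
  minor (suc n) {i} {j} i<j j≤ j<len P | yes i≡j | k , i<k , k<j , i≢k , departing | l , l<len , Q | yes k≡l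
    with <-cmp l i
  -- The ears cross in the order `l`, `i`, `k`, `j`, with `Q` read backwards.
  ... | tri< l<i _ _ = inj₂ (k4 l<i i<k k<j j<len (sym k≡l) i≡j (λ l≡i → i≢k (trans (sym l≡i) (sym k≡l))) (ear-sym Q) P)
  ... | tri≈ _ refl _ = contradiction (sym k≡l) i≢k
  ... | tri> _ _ i<l with <-cmp l j
  ... | tri> _ _ j<l = inj₂ (k4 i<k k<j j<l l<len i≡j k≡l i≢k P Q)
  ... | tri≈ _ refl _ = contradiction (trans i≡j (sym k≡l)) i≢k
  -- Both ends of `Q` lie strictly between `i` and `j`, so its span is smaller.
  ... | tri< l<j _ _ with <-cmp k l
  ... | tri< k<l _ _ = minor n k<l (≤-trans (s≤s⁻¹ (≤-trans l<j j≤)) (+-monoʳ-≤ n (<⇒≤ i<k))) l<len Q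
  ... | tri≈ _ refl _ = contradiction refl (ends-differ Q ∘ cong vertex)
  ... | tri> _ _ l<k = minor n l<k (≤-trans (s≤s⁻¹ (≤-trans k<j j≤)) (+-monoʳ-≤ n (<⇒≤ i<l))) (<-trans k<j j<len) (ear-sym Q)

  departure-minor : ∀ {i} → i < len → ¬ Side (edge L (vertex i)) → (Θ IsConformalMinorOf G) ⊎ (K₄ IsConformalMinorOf G)
  departure-minor {i} i<len departing with ear {i} departing
  ... | j , j<len , P with <-cmp i j
  ... | tri< i<j _ _  = minor j i<j (m≤m+n j i) j<len P
  ... | tri≈ _ refl _ = contradiction refl (ends-differ P)
  ... | tri> _ _ j<i  = minor i j<i (m≤m+n i j) i<len (ear-sym P)

-- The excluded graphs

-- If `M` contains every edge, edges sharing an end coincide. By connectivity every vertex is then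
-- an end of `e₀`, and `e₀` is the only edge.
≅K₂ : ∀ {G} → Connected G → (M : Matching G) → (∀ e → T (member M e)) → E G → G ≅ K₂
≅K₂ {G} connected M everywhere e₀ =
  ≅-intro φ (λ _ → e₀) φ-injective φ-surjective
    (λ {e} {e′} _ → K₂-unique e e′) (λ e → (zero , suc zero , s≤s z≤n) , sole e)
    (λ { (zero , suc zero , _) → inj₁ (refl , refl) ; (_ , zero , ()) ; (suc zero , suc zero , s≤s ()) })
  where
  φ : Fin 2 → V G
  φ zero       = src G e₀
  φ (suc zero) = tgt G e₀

  φ-injective : ∀ {u v} → φ u ≡ φ v → u ≡ v
  φ-injective {zero} {zero} _ = refl
  φ-injective {zero} {suc zero} eq = contradiction eq (loopless G e₀)
  φ-injective {suc zero} {zero} eq = contradiction (sym eq) (loopless G e₀)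
  φ-injective {suc zero} {suc zero} _ = refl

  same-edge : ∀ {e e′ v} → Incident G e v → Incident G e′ v → e ≡ e′
  same-edge e∼v e′∼v = trans (sym (edge-unique M (everywhere _) e∼v)) (edge-unique M (everywhere _) e′∼v)

  spread : ∀ {u v} → Star (Adjacent G) u v → Incident G e₀ u → Incident G e₀ v
  spread ε e₀∼u = e₀∼u
  spread ((e , j) ◅ rest) e₀∼u with same-edge e₀∼u (joins⇒incident {G} j)
  ... | refl = spread rest (joins⇒incident {G} (joins-sym {G} j))

  incident : ∀ v → Incident G e₀ v
  incident v = spread (connected (src G e₀) v) (inj₁ refl)

  φ-surjective : ∀ v → ∃ λ i → φ i ≡ v
  φ-surjective v with incident v
  ... | inj₁ eq = zero , eq
  ... | inj₂ eq = suc zero , eq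

  sole : ∀ e → e₀ ≡ e
  sole e = same-edge (incident (src G e)) (inj₁ refl)

  K₂-unique : ∀ (e e′ : E K₂) → e ≡ e′
  K₂-unique (zero , suc zero , p) (zero , suc zero , q) = complete-simple (zero , suc zero , p) (zero , suc zero , q) (inj₁ (refl , refl))
  K₂-unique (_ , zero , ()) _
  K₂-unique (suc zero , suc zero , s≤s ()) _
  K₂-unique _ (_ , zero , ())
  K₂-unique _ (suc zero , suc zero , s≤s ())

module _ {G : Graph} (_≟V_ : DecidableEquality (V G)) (_≟E_ : DecidableEquality (E G))
         {M : Matching G} (C : AlternatingCycle M) where
  open AlternatingCycle C
  open CycleProperties _≟V_ _≟E_ C

  -- A path from the cycle uses sides only, so by connectivity the cycle exhausts the graph.
  ≅cycle : Connected G → (∀ e i → Incident G e (vertex i) → Side e) → G ≅ cycle (2 * m)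
  ≅cycle connected all-sides =
    -- Edge `i` of `cycle` ends at vertex `i`, whereas `side i` starts there. Adding `suc (2 * m)`,
    -- that is `len - 1`, shifts back by one cyclically.
    ≅-intro (vertex ∘ toℕ) (λ i → side (toℕ i + suc (2 * m)))
      (λ {i} {j} eq → toℕ-injective (vertex-injective z≤n (toℕ<n i) z≤n (toℕ<n j) eq))
      vertex-surjective side-injective side-surjective joins
    where
    spread : ∀ {u v} → Star (Adjacent G) u v → OnCycle u → OnCycle v
    spread ε u∈ = u∈
    spread ((e , j) ◅ rest) (i , _ , refl) =
      spread rest (side-incident (all-sides e i (joins⇒incident {G} j)) (joins⇒incident {G} (joins-sym {G} j)))

    vertex-surjective : ∀ v → ∃ λ (i : Fin len) → vertex (toℕ i) ≡ v
    vertex-surjective v with spread (connected (vertex 0) v) (onCycle 0)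
    ... | i , i<len , eq = fromℕ< i<len , trans (cong vertex (toℕ-fromℕ< i<len)) eq

    within : ∀ (i j : Fin len) → toℕ j + suc (2 * m) < toℕ i + suc (2 * m) + len
    within i j = <-≤-trans (+-monoˡ-< _ (toℕ<n j)) (≤-trans (≤-reflexive (+-comm len _)) (+-monoˡ-≤ len (m≤n+m _ (toℕ i))))

    side-injective : ∀ {i j : Fin len} → side (toℕ i + suc (2 * m)) ≡ side (toℕ j + suc (2 * m)) → i ≡ j
    side-injective {i} {j} eq with <-cmp (toℕ i) (toℕ j)
    ... | tri≈ _ i≡j _ = toℕ-injective i≡j
    ... | tri< i<j _ _ = contradiction eq (side-inj (+-monoˡ-< _ i<j) (within i j))
    ... | tri> _ _ j<i = contradiction (sym eq) (side-inj (+-monoˡ-< _ j<i) (within j i))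

    side-surjective : ∀ e → ∃ λ (i : Fin len) → side (toℕ i + suc (2 * m)) ≡ e
    side-surjective e with vertex-surjective (src G e)
    ... | i , i≡ with all-sides e (toℕ i) (inj₁ (sym i≡))
    ... | j , j<len , refl with m≤n⇒m<n∨m≡n j<len
    ... | inj₂ refl    = zero , refl
    ... | inj₁ 1+j<len = fromℕ< 1+j<len ,
      trans (cong (λ k → side (k + suc (2 * m))) (toℕ-fromℕ< 1+j<len)) (trans (cong side (sym (+-suc j _))) (side-+len j))

    joins : ∀ i → Joins G (side (toℕ i + suc (2 * m))) (vertex (toℕ (src (cycle (2 * m)) i))) (vertex (toℕ i))
    joins i = subst (λ (u , v) → Joins G (side (toℕ i + suc (2 * m))) u v) (cong₂ _,_ (source i) (target i)) (side-joins _)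
      where
      source : ∀ i → vertex (toℕ i + suc (2 * m)) ≡ vertex (toℕ (src (cycle (2 * m)) i))
      source zero    = cong vertex (sym (toℕ-fromℕ (suc (2 * m))))
      source (suc i) = trans (cong vertex (sym (+-suc (toℕ i) _))) (trans (vertex-+len (toℕ i)) (cong vertex (sym (toℕ-inject₁ i))))
      target : ∀ i → vertex (suc (toℕ i + suc (2 * m))) ≡ vertex (toℕ i)
      target i = trans (cong vertex (sym (+-suc (toℕ i) _))) (vertex-+len (toℕ i))

-- Choosing the matchings and excluding the exceptional graphs

module _ {G : Graph} {n : ℕ} (V↔Fin : V G ↔ Fin n) (_≟E_ : DecidableEquality (E G)) (search-E : Searchable (E G))
         (connected : Connected G) (through : ∀ e → ∃ λ (M : Matching G) → ∀ {v} → Incident G e v → edge M v ≡ e)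
         where

  cycle-minor : ¬ IsEvenCycle G → {M : Matching G} → AlternatingCycle M →
                (Θ IsConformalMinorOf G) ⊎ (K₄ IsConformalMinorOf G)
  cycle-minor not-cycle C = leave (search-E λ e → anyUpTo? (λ i → incident? e (vertex i) ×-dec ¬? (side? e)) len)
    where
    open AlternatingCycle C
    open CycleProperties (↔Fin⇒≟ V↔Fin) _≟E_ C

    incident? : ∀ e v → Dec (Incident G e v)
    incident? e v = ↔Fin⇒≟ V↔Fin (src G e) v ⊎-dec ↔Fin⇒≟ V↔Fin (tgt G e) v

    leave : Dec (∃ λ e → ∃ λ i → i < len × Incident G e (vertex i) × ¬ Side e) →
            (Θ IsConformalMinorOf G) ⊎ (K₄ IsConformalMinorOf G)
    leave (yes (e , i , i<len , e∼i , e∉)) =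
      -- `L` is chosen through `e`, so that the `L`-edge at `vertex i` is `e` itself.
      Minors.departure-minor V↔Fin _≟E_ C (proj₁ (through e)) i<len (e∉ ∘ subst Side (proj₂ (through e) e∼i))
    leave (no none) = contradiction (m , ≅cycle (↔Fin⇒≟ V↔Fin) _≟E_ C connected all-sides) not-cycle
      where
      all-sides : ∀ e i → Incident G e (vertex i) → Side e
      all-sides e i e∼i with side? e
      ... | yes e∈ = e∈
      ... | no  e∉ with onCycle i
      ... | j , j<len , eq = contradiction (e , j , j<len , subst (Incident G e) (sym eq) e∼i , e∉) none

  matching-minor : ¬ (G ≅ K₂) → ¬ IsEvenCycle G → E G → (M : Matching G) →
                   (Θ IsConformalMinorOf G) ⊎ (K₄ IsConformalMinorOf G)
  matching-minor G≇K₂ not-cycle e₀ M with search-E (λ f → ¬? (T? (member M f)))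
  -- `M` avoids `f`, so it differs from a perfect matching through `f` at the ends of `f`, where the
  -- alternating walk can start.
  ... | yes (f , f∉M) = cycle-minor not-cycle (alternatingCycle V↔Fin M (proj₁ (through f)) {src G f} differ)
    where
    differ : edge M (src G f) ≢ edge (proj₁ (through f)) (src G f)
    differ eq = f∉M (subst (T ∘ member M) (trans eq (proj₂ (through f) (inj₁ refl))) (edge-member M (src G f)))
  ... | no none = contradiction (≅K₂ connected M everywhere e₀) G≇K₂
    where
    everywhere : ∀ e → T (member M e)
    everywhere e with T? (member M e)
    ... | yes e∈M = e∈M
    ... | no  e∉M = contradiction (e , e∉M) none

edge-exists : ∀ {G} (fin : Finite G) → 2 ≤ order fin → Connected G → E G
edge-exists {G} fin order≥2 connected = first (connected u v) u≢v
  where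
  u v : V G
  u = Inverse.from (vertices fin) (fromℕ< (<⇒≤ order≥2))
  v = Inverse.from (vertices fin) (fromℕ< order≥2)

  u≢v : u ≢ v
  u≢v eq = 0≢1+n (trans (sym (toℕ-fromℕ< (<⇒≤ order≥2)))
    (trans (cong toℕ (Injection.injective (↔⇒↣ (↔-sym (vertices fin))) eq)) (toℕ-fromℕ< order≥2)))

  first : ∀ {u v} → Star (Adjacent G) u v → u ≢ v → E G
  first ε             u≢u = contradiction refl u≢u
  first ((e , _) ◅ _) _   = e

theorem1p5 : (G : Graph) → MatchingCovered G → ¬ (G ≅ K₂) → ¬ IsEvenCycle G →
    (Θ IsConformalMinorOf G) ⊎ (K₄ IsConformalMinorOf G)
theorem1p5 G covering G≇K₂ not-cycle =
  -- `e₀` supplies the initial perfect matching, and also the edge of `K₂` should that matching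
  -- contain all edges.
  matching-minor (vertices finite) (↔Fin⇒≟ (edges finite)) (search-↔ (edges finite) any?) connected through
    G≇K₂ not-cycle e₀ (proj₁ (through e₀))
  where
  open MatchingCovered covering

  through : ∀ e → ∃ λ (M : Matching G) → ∀ {v} → Incident G e v → edge M v ≡ e
  through e with covered e
  ... | M , perfect , e∈M = record { member = M ; perfect = perfect } ,
                            λ {v} → edge-unique {G} (record { member = M ; perfect = perfect }) {e} {v} e∈M

  e₀ : E G
  e₀ = edge-exists finite order≥2 connected
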